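{- For every positive integer $n$, the triples of statistics $(S_{10},S_{12},S_{17})$ and $(S_{12},S_{10},S_{17})$ are equidistributed over the symmetric group $\mathfrak S_n$; that is, for all integers $a,b,c$, $$\#\{p\in\mathfrak S_n:(S_{10},S_{12},S_{17})(p)=(a,b,c)\}=\#\{p\in\mathfrak S_n:(S_{12},S_{10},S_{17})(p)=(a,b,c)\}.$$
   Context: For $p=p_1p_2\cdots p_n\in\mathfrak S_n$ in one-line notation, with $\mathbb O$ the set of odd positive integers: $S_{10}(p)=|\{i\in[n-1]:p_i>p_{i+1}\text{ and }p_i\in\mathbb O\}|$; $S_{12}(p)=|\{i\in[n-1]:p_i,p_{i+1}\in\mathbb O\}|$; $S_{17}(p)$ is the largest $i\in[n]$ such that the elements $1,2,\dots,i$ appear in this order from left to right in $p$. -}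

module Defs where

open import Data.Fin as Fin using (Fin; zero; suc; toℕ; inject₁)
open import Data.Fin.Permutation
  using (Permutation′; _⟨$⟩ʳ_; _≈_; id; insert; remove; insert-remove)
open import Data.Fin.Properties using (all?; punchIn-injective)
open import Data.Integer as ℤ using (ℤ)
open import Data.List
  using (List; []; _∷_; allFin; cartesianProductWith; filter; length; map; upTo)
open import Data.List.Extrema.Nat using (max)
open import Data.List.Membership.Propositional.Properties using (∈-allFin)
open import Data.List.Relation.Unary.All using ([])
open import Data.List.Relation.Unary.AllPairs using ([]; _∷_)
open import Data.List.Relation.Unary.Any using (Any; here)
import Data.List.Relation.Unary.Any.Properties as Any
import Data.List.Relation.Unary.Unique.Propositional.Properties as Unique
import Data.List.Relation.Unary.Unique.Setoid as UniqueSetoid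
import Data.List.Relation.Unary.Unique.Setoid.Properties as UniqueSetoid
open import Data.Nat as ℕ using (ℕ; zero; suc; _<_; _≤_; _%_)
open import Data.Product using (_×_; _,_)
open import Data.Product.Properties using (≡-dec)
open import Level using (0ℓ)
open import Relation.Binary using (Setoid; DecidableEquality)
open import Relation.Binary.PropositionalEquality
  using (_≡_; refl; sym; trans; cong; setoid)
open import Relation.Nullary.Decidable using (_×-dec_; _→-dec_)
open import Relation.Unary using (Pred; Decidable)

-- Permutation′ n carries inverse proofs, so its elements are compared by the
-- pointwise equality _≈_ rather than by _≡_.
permutationSetoid : ℕ → Setoid 0ℓ 0ℓ
permutationSetoid n = record
  { Carrier       = Permutation′ n
  ; _≈_           = _≈_
  ; isEquivalence = record
    { refl  = λ _ → refl
    ; sym   = λ p i → sym (p i)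
    ; trans = λ p q i → trans (p i) (q i)
    }
  }

-- Every element of 𝔖ₙ exactly once; see permutations-complete and
-- permutations-unique.
permutations : ∀ n → List (Permutation′ n)
permutations zero    = id ∷ []
permutations (suc n) =
  cartesianProductWith (insert zero) (allFin (suc n)) (permutations n)

private
  insert-cong : ∀ {n} {j k : Fin (suc n)} {π ρ : Permutation′ n} →
                j ≡ k → π ≈ ρ → insert zero j π ≈ insert zero k ρ
  insert-cong refl π≈ρ zero    = refl
  insert-cong {j = j} refl π≈ρ (suc i) = cong (Fin.punchIn j) (π≈ρ i)

  insert-injective : ∀ {n} {j k : Fin (suc n)} {π ρ : Permutation′ n} →
                     insert zero j π ≈ insert zero k ρ → j ≡ k × π ≈ ρ
  insert-injective {j = j} {k} {π} {ρ} eq with eq zero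
  ... | refl = refl , λ i → punchIn-injective j _ _ (eq (suc i))

permutations-complete : ∀ {n} (π : Permutation′ n) → Any (π ≈_) (permutations n)
permutations-complete {zero}  π = here λ ()
permutations-complete {suc n} π =
  Any.cartesianProductWith⁺ (insert zero)
    (λ eq π≈ρ i → trans (sym (insert-remove zero π i)) (insert-cong eq π≈ρ i))
    (∈-allFin (π ⟨$⟩ʳ zero))
    (permutations-complete (remove zero π))

permutations-unique : ∀ n → UniqueSetoid.Unique (permutationSetoid n) (permutations n)
permutations-unique zero    = [] ∷ []
permutations-unique (suc n) =
  UniqueSetoid.cartesianProductWith⁺
    (setoid (Fin (suc n))) (permutationSetoid n) (permutationSetoid (suc n))
    (insert zero) insert-injective
    (Unique.allFin⁺ (suc n)) (permutations-unique n)

#_ : ∀ {n} {P : Pred (Permutation′ n) 0ℓ} → Decidable P → ℕ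
#_ {n} P? = length (filter P? (permutations n))

-- π sends the position i to the entry pᵢ.  Positions and values in Fin n start
-- from 0, so the shift by one makes the entries range over 1,…,n.
entry : ∀ {n} → Permutation′ n → Fin n → ℕ
entry π i = suc (toℕ (π ⟨$⟩ʳ i))

Odd : Pred ℕ 0ℓ
Odd k = k % 2 ≡ 1

odd? : Decidable Odd
odd? k = k % 2 ℕ.≟ 1

-- In the first two statistics n = suc m, so [n-1] is Fin m, and i : Fin m
-- stands for the adjacent positions inject₁ i and suc i.

S₁₀ : ∀ {m} → Permutation′ (suc m) → ℕ
S₁₀ {m} π = length (filter
  (λ i → (entry π (inject₁ i) ℕ.>? entry π (suc i)) ×-dec odd? (entry π (inject₁ i)))
  (allFin m))

S₁₂ : ∀ {m} → Permutation′ (suc m) → ℕ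
S₁₂ {m} π = length (filter
  (λ i → odd? (entry π (inject₁ i)) ×-dec odd? (entry π (suc i)))
  (allFin m))

InOrder : ∀ {n} → Permutation′ n → Pred ℕ 0ℓ
InOrder {n} π k =
  ∀ (s t : Fin n) → entry π s < entry π t → entry π t ≤ k → s Fin.< t

inOrder? : ∀ {n} (π : Permutation′ n) → Decidable (InOrder π)
inOrder? π k = all? λ s → all? λ t →
  (entry π s ℕ.<? entry π t) →-dec ((entry π t ℕ.≤? k) →-dec (s Fin.<? t))

-- The default value 0 of max is never attained, since k = 1 always qualifies.
S₁₇ : ∀ {m} → Permutation′ (suc m) → ℕ
S₁₇ {m} π = max 0 (filter (inOrder? π) (map suc (upTo (suc m))))

infix 4 _≟³_
_≟³_ : DecidableEquality (ℤ × ℤ × ℤ)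
_≟³_ = ≡-dec ℤ._≟_ (≡-dec ℤ._≟_ ℤ._≟_)

{-# OPTIONS --safe #-}

-- Prepend 0 to p and sort the pairs (x , y) of adjacent entries by the parities
-- of x and y and, for odd x, by whether x > y.  Let a, b, c count the pairs with
-- odd > odd, odd > even and odd < odd, so that S₁₀ = a + b and S₁₂ = a + c, and
-- let e ∈ {0 , 1} say whether the last entry is odd.  Grow permutations by
-- inserting n + 1 into a permutation of [n].  How (a , b , c , e , S₁₇) changes
-- depends only on the kind of the pair that is split, so these data form a Markov
-- chain.  This chain is invariant under b ↔ c.  The only delicate case is odd
-- n + 1: splitting a pair odd > odd or odd > even or, if e = 1, appending, raises
-- c alone, and this happens in a + b + e ways, whereas b alone is raised by
-- splitting an even-even pair.  There are a + c + e of those: [n] contains as many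
-- odd as even numbers, so as many pairs end in an even entry as there are odd
-- entries, and every odd entry except a last one begins a pair.  S₁₇ changes only
-- when n + 1 is appended to the identity.

module Submission where

open import Defs
open import Data.Bool using (Bool; true; false; not; _∧_; if_then_else_)
open import Data.Fin as Fin using (Fin; zero; suc; toℕ; inject₁; fromℕ; punchIn)
open import Data.Fin.Permutation as Permutation
  using (Permutation′; _⟨$⟩ʳ_; _⟨$⟩ˡ_; _≈_; insert; remove; insert-punchIn; insert-remove)
import Data.Fin.Properties as Fin
open import Data.Integer using (ℤ; +_)
open import Data.List
  using (List; []; _∷_; _++_; _∷ʳ_; allFin; cartesianProductWith; filter; length; map; tabulate; upTo)
open import Data.List.Extrema.Nat using (argmax-all; xs≤max)
open import Data.List.Membership.Propositional using (_∈_)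
import Data.List.Membership.Propositional.Properties as Membership
import Data.List.Membership.Setoid as SetoidMembership
open import Data.List.Membership.Setoid.Properties using (∈-∃++; ∈-resp-≈)
open import Data.List.Properties
  using (map-∘; map-cong; map-cong-local; map-tabulate; map-++; tabulate-cong)
import Data.List.Relation.Binary.Permutation.Setoid as SetoidPermutation
import Data.List.Relation.Binary.Permutation.Setoid.Properties as SetoidPermutationₚ
open import Data.List.Relation.Unary.All as All using (All; []; _∷_)
import Data.List.Relation.Unary.All.Properties as All
open import Data.List.Relation.Unary.AllPairs using ([]; _∷_)
open import Data.List.Relation.Unary.Any using (Any; here; there)
import Data.List.Relation.Unary.Any.Properties as Any
import Data.List.Relation.Unary.Unique.Propositional.Properties as Unique
import Data.List.Relation.Unary.Unique.Setoid as UniqueSetoid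
open import Data.List.Relation.Unary.Unique.Setoid.Properties using (Unique[x∷xs]⇒x∉xs)
import Data.List.Relation.Unary.Unique.Setoid.Properties as UniqueSetoidₚ
open import Data.Nat
  using (ℕ; zero; suc; pred; _+_; _*_; _∸_; _≤_; _<_; _≟_; _<?_; _>?_; z≤n; s≤s)
open import Data.Nat.ListAction using (sum)
open import Data.Nat.ListAction.Properties using (sum-++)
open import Data.Nat.Properties hiding (_≟_; _<?_; _>?_)
open import Data.Nat.Tactic.RingSolver using (solve-∀)
open import Data.Product using (_×_; _,_; proj₁; proj₂)
import Data.Vec.Functional as Vector
import Data.Vec.Functional.Properties as Vector
open import Algebra.Properties.CommutativeMonoid.Sum +-0-commutativeMonoid
  using (sum-permute) renaming (sum to vsum)
open import Function using (_∘_; id)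
open import Level using (0ℓ)
import Relation.Binary as Binary
open import Relation.Binary.PropositionalEquality
  using (_≡_; _≢_; _≗_; refl; sym; trans; cong; cong₂; subst; subst₂; setoid; module ≡-Reasoning)
open import Relation.Nullary using (Dec; ¬_; yes; no; does; contradiction)
open import Relation.Nullary.Decidable using (dec-true; dec-false; _×-dec_)
open import Relation.Unary using (Pred; Decidable)

private
  variable
    X Y Z : Set
    n : ℕ

-- Sums over lists

∑ : List X → (X → ℕ) → ℕ
∑ xs f = sum (map f xs)

∑-cong : ∀ {f g : X → ℕ} → (∀ x → f x ≡ g x) → ∀ xs → ∑ xs f ≡ ∑ xs g
∑-cong f≗g xs = cong sum (map-cong f≗g xs)

∑-map : ∀ (f : Y → ℕ) (g : X → Y) xs → ∑ (map g xs) f ≡ ∑ xs (f ∘ g)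
∑-map f g xs = cong sum (sym (map-∘ xs))

∑-++ : ∀ (f : X → ℕ) xs ys → ∑ (xs ++ ys) f ≡ ∑ xs f + ∑ ys f
∑-++ f xs ys = trans (cong sum (map-++ f xs ys)) (sum-++ (map f xs) (map f ys))

∑-cartesianProductWith : ∀ (f : Z → ℕ) (g : X → Y → Z) xs ys →
  ∑ (cartesianProductWith g xs ys) f ≡ ∑ xs (λ x → ∑ ys (λ y → f (g x y)))
∑-cartesianProductWith f g []       ys = refl
∑-cartesianProductWith f g (x ∷ xs) ys = trans
  (∑-++ f (map (g x) ys) (cartesianProductWith g xs ys))
  (cong₂ _+_ (∑-map f (g x) ys) (∑-cartesianProductWith f g xs ys))

𝟙 : Bool → ℕ
𝟙 b = if b then 1 else 0

length-filter≡∑ : ∀ {P : Pred X 0ℓ} (P? : Decidable P) xs →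
                  length (filter P? xs) ≡ ∑ xs (λ x → 𝟙 (does (P? x)))
length-filter≡∑ P? []       = refl
length-filter≡∑ P? (x ∷ xs) with does (P? x)
... | true  = cong suc (length-filter≡∑ P? xs)
... | false = length-filter≡∑ P? xs

-- Duplicate-free lists with the same elements

module _ (S : Binary.Setoid 0ℓ 0ℓ) where
  open Binary.Setoid S using (Carrier) renaming (_≈_ to _∼_; refl to ∼-refl; sym to ∼-sym; trans to ∼-trans)
  open UniqueSetoid S using (Unique)
  open SetoidMembership S using () renaming (_∈_ to _∈ₛ_)
  open SetoidPermutation S using (_↭_; ↭-trans; ↭-prep; ↭-refl; ↭-sym; ↭-reflexive-≋)
  open SetoidPermutationₚ S using (shift; Unique-resp-↭; ∈-resp-↭)

  -- The head `x` occurs in `ys` and can be moved to the front there. Freeness from duplicates keeps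
  -- `x` out of both remainders, so these again have the same elements.
  unique∧set⇒↭ : ∀ {xs ys} → Unique xs → Unique ys →
                 (∀ {x} → x ∈ₛ xs → x ∈ₛ ys) → (∀ {x} → x ∈ₛ ys → x ∈ₛ xs) → xs ↭ ys
  unique∧set⇒↭ {[]}     {[]}     _ _ _ _ = ↭-refl
  unique∧set⇒↭ {[]}     {y ∷ ys} _ _ _ ⊇ with () ← ⊇ (here ∼-refl)
  unique∧set⇒↭ {x ∷ xs} {ys} (x∉xs ∷ xs!) ys! ⊆ ⊇
    with as , bs , w , x∼w , ys≋ ← ∈-∃++ S (⊆ (here ∼-refl))
    = ↭-trans (↭-prep x (unique∧set⇒↭ xs! rest! ⊆′ ⊇′)) (↭-sym ys↭)
    where
    ys↭ : ys ↭ x ∷ as ++ bs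
    ys↭ = ↭-trans (↭-reflexive-≋ ys≋) (shift (∼-sym x∼w) as bs)

    x∷rest! : Unique (x ∷ as ++ bs)
    x∷rest! = Unique-resp-↭ ys↭ ys!

    rest! : Unique (as ++ bs)
    rest! with _ ∷ r ← x∷rest! = r

    ⊆′ : ∀ {z} → z ∈ₛ xs → z ∈ₛ as ++ bs
    ⊆′ z∈ with ∈-resp-↭ ys↭ (⊆ (there z∈))
    ... | there z∈′ = z∈′
    ... | here z∼x  = contradiction (∈-resp-≈ S z∼x z∈) (Unique[x∷xs]⇒x∉xs S (x∉xs ∷ xs!))

    ⊇′ : ∀ {z} → z ∈ₛ as ++ bs → z ∈ₛ xs
    ⊇′ z∈ with ⊇ (∈-resp-↭ (↭-sym ys↭) (there z∈))
    ... | there z∈′ = z∈′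
    ... | here z∼x  = contradiction (∈-resp-≈ S z∼x z∈) (Unique[x∷xs]⇒x∉xs S x∷rest!)

  ∑-unique : ∀ {f : Carrier → ℕ} → (∀ {x y} → x ∼ y → f x ≡ f y) → ∀ {xs ys} →
             Unique xs → Unique ys →
             (∀ {x} → x ∈ₛ xs → x ∈ₛ ys) → (∀ {x} → x ∈ₛ ys → x ∈ₛ xs) → ∑ xs f ≡ ∑ ys f
  ∑-unique f-cong xs! ys! ⊆ ⊇ =
    SetoidPermutationₚ.foldr-commMonoid (setoid ℕ) +-0-isCommutativeMonoid
      (SetoidPermutationₚ.map⁺ S (setoid ℕ) f-cong (unique∧set⇒↭ xs! ys! ⊆ ⊇))

-- Permutations grown by inserting the maximum

-- `permutations` adds a new first position and relabels the other entries. Here the new entry is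
-- the largest, so the others keep their values and their order, and at most one adjacent pair is
-- broken up.
permutationsByMax : ∀ n → List (Permutation′ n)
permutationsByMax zero    = Permutation.id ∷ []
permutationsByMax (suc n) =
  cartesianProductWith (λ π j → insert j (fromℕ n) π) (permutationsByMax n) (allFin (suc n))

insert-same : ∀ (j k : Fin (suc n)) (π : Permutation′ n) → insert j k π ⟨$⟩ʳ j ≡ k
insert-same j k π with j Fin.≟ j
... | yes _  = refl
... | no j≢j = contradiction refl j≢j

data PunchInView {n} (j : Fin (suc n)) : Fin (suc n) → Set where
  same  : PunchInView j j
  other : ∀ k → PunchInView j (punchIn j k)

punchInView : ∀ (j k : Fin (suc n)) → PunchInView j k
punchInView j k with j Fin.≟ k
... | yes refl = same
... | no j≢k   = subst (PunchInView j) (Fin.punchIn-punchOut j≢k) (other _)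

insert-cong : ∀ (j k : Fin (suc n)) {π ρ : Permutation′ n} →
              π ≈ ρ → insert j k π ≈ insert j k ρ
insert-cong j k {π} {ρ} π≈ρ i with punchInView j i
... | same    = trans (insert-same j k π) (sym (insert-same j k ρ))
... | other i = begin
  insert j k π ⟨$⟩ʳ punchIn j i ≡⟨ insert-punchIn j k π i ⟩
  punchIn k (π ⟨$⟩ʳ i)          ≡⟨ cong (punchIn k) (π≈ρ i) ⟩
  punchIn k (ρ ⟨$⟩ʳ i)          ≡⟨ insert-punchIn j k ρ i ⟨
  insert j k ρ ⟨$⟩ʳ punchIn j i ∎
  where open ≡-Reasoning

permutationsByMax-complete : ∀ {n} (π : Permutation′ n) → Any (π ≈_) (permutationsByMax n)
permutationsByMax-complete {zero}  π = here λ ()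
permutationsByMax-complete {suc n} π =
  Any.cartesianProductWith⁺ (λ ρ j → insert j (fromℕ n) ρ) combine
    (permutationsByMax-complete (remove j₀ π)) (Membership.∈-allFin j₀)
  where
  j₀ : Fin (suc n)
  j₀ = π ⟨$⟩ˡ fromℕ n

  combine : ∀ {ρ j} → remove j₀ π ≈ ρ → j₀ ≡ j → π ≈ insert j (fromℕ n) ρ
  combine {ρ} eq refl i = begin
    π ⟨$⟩ʳ i                                              ≡⟨ insert-remove j₀ π i ⟨
    insert j₀ (π ⟨$⟩ʳ j₀) (remove j₀ π) ⟨$⟩ʳ i            ≡⟨ cong (λ k → insert j₀ k (remove j₀ π) ⟨$⟩ʳ i) (Permutation.inverseʳ π) ⟩
    insert j₀ (fromℕ n) (remove j₀ π) ⟨$⟩ʳ i              ≡⟨ insert-cong j₀ (fromℕ n) {remove j₀ π} {ρ} eq i ⟩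
    insert j₀ (fromℕ n) ρ ⟨$⟩ʳ i                          ∎
    where open ≡-Reasoning

permutationsByMax-unique : ∀ n → UniqueSetoid.Unique (permutationSetoid n) (permutationsByMax n)
permutationsByMax-unique zero    = [] ∷ []
permutationsByMax-unique (suc n) =
  UniqueSetoidₚ.cartesianProductWith⁺
    (permutationSetoid n) (setoid (Fin (suc n))) (permutationSetoid (suc n))
    (λ π j → insert j (fromℕ n) π) injective
    (permutationsByMax-unique n) (Unique.allFin⁺ (suc n))
  where
  injective : ∀ {π ρ j k} → insert j (fromℕ n) π ≈ insert k (fromℕ n) ρ → π ≈ ρ × j ≡ k
  injective {π} {ρ} {j} {k} eq with punchInView j k
  -- If `k` differs from `j`, the left side takes at `k` a value of the form `punchIn (fromℕ n) _`,
  -- which is never the maximum, while the right side takes the maximum there.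
  ... | other i = contradiction
        (trans (sym (insert-punchIn j (fromℕ n) π i)) (trans (eq k) (insert-same k (fromℕ n) ρ)))
        (Fin.punchInᵢ≢i (fromℕ n) (π ⟨$⟩ʳ i))
  ... | same    = π≈ρ , refl
    where
    open ≡-Reasoning
    π≈ρ : π ≈ ρ
    π≈ρ i = Fin.punchIn-injective (fromℕ n) _ _ (begin
      punchIn (fromℕ n) (π ⟨$⟩ʳ i)          ≡⟨ insert-punchIn j (fromℕ n) π i ⟨
      insert j (fromℕ n) π ⟨$⟩ʳ punchIn j i ≡⟨ eq (punchIn j i) ⟩
      insert j (fromℕ n) ρ ⟨$⟩ʳ punchIn j i ≡⟨ insert-punchIn j (fromℕ n) ρ i ⟩
      punchIn (fromℕ n) (ρ ⟨$⟩ʳ i)          ∎)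

∑-permutations : ∀ {f : Permutation′ n → ℕ} → (∀ {π ρ} → π ≈ ρ → f π ≡ f ρ) →
                 ∑ (permutations n) f ≡ ∑ (permutationsByMax n) f
∑-permutations {n} f-cong = ∑-unique (permutationSetoid n) (λ {π} {ρ} → f-cong {π} {ρ})
  (permutations-unique n) (permutationsByMax-unique n)
  (λ {π} _ → permutationsByMax-complete π) (λ {π} _ → permutations-complete π)

-- Kinds of adjacent pairs

odd : ℕ → Bool
odd k = does (odd? k)

-- For odd `x` the pairs `x`, `y` are `A`: odd > odd, `B`: odd > even, `C`: odd < odd, `D`: odd <
-- even. For even `x` neither statistic counts the pair, so only the parity of `y` is kept: `G` for
-- odd, `H` for even.
data Kind : Set where
  A B C D G H : Kind

classify : (odd-x odd-y y<x : Bool) → Kind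
classify true  true  true  = A
classify true  false true  = B
classify true  true  false = C
classify true  false false = D
classify false true  _     = G
classify false false _     = H

kind : ℕ → ℕ → Kind
kind x y = classify (odd x) (odd y) (does (y <? x))

top bottom : Kind → Bool
top A = true
top B = true
top C = true
top D = true
top G = false
top H = false
bottom A = true
bottom B = false
bottom C = true
bottom D = false
bottom G = true
bottom H = false

top-kind : ∀ x y → top (kind x y) ≡ odd x
top-kind x y with does (odd? x) | does (odd? y) | does (y <? x)
... | true  | true  | true  = refl
... | true  | true  | false = refl
... | true  | false | true  = refl
... | true  | false | false = refl
... | false | true  | _     = refl
... | false | false | _     = refl

bottom-kind : ∀ x y → bottom (kind x y) ≡ odd y
bottom-kind x y with does (odd? x) | does (odd? y) | does (y <? x)
... | true  | true  | true  = refl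
... | true  | true  | false = refl
... | true  | false | true  = refl
... | true  | false | false = refl
... | false | true  | _     = refl
... | false | false | _     = refl

kinds : ℕ → List ℕ → List Kind
kinds x []      = []
kinds x (y ∷ w) = kind x y ∷ kinds y w

final : ℕ → List ℕ → ℕ
final x []      = x
final x (y ∷ w) = final y w

δ : Kind → Kind → ℕ
δ A A = 1
δ B B = 1
δ C C = 1
δ D D = 1
δ G G = 1
δ H H = 1
δ _ _ = 0

count : Kind → List Kind → ℕ
count i ks = ∑ ks (δ i)

weigh : (g multiplicity : Kind → ℕ) → ℕ
weigh g m = m A * g A + (m B * g B + (m C * g C + (m D * g D + (m G * g G + m H * g H))))

∑-kinds : ∀ (g : Kind → ℕ) ks → ∑ ks g ≡ weigh g (λ i → count i ks)
∑-kinds g []       = refl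
∑-kinds g (k ∷ ks) = trans (cong (λ r → g k + r) (∑-kinds g ks)) (absorb k)
  where
  t : Kind → ℕ
  t i = count i ks * g i

  pull : ∀ x p {q r} → x + q ≡ r → x + (p + q) ≡ p + r
  pull x p {q} refl =
    trans (sym (+-assoc x p q)) (trans (cong (_+ q) (+-comm x p)) (+-assoc p x q))

  stop : ∀ x p q → x + (p + q) ≡ (x + p) + q
  stop x p q = sym (+-assoc x p q)

  -- As `δ` computes, `count i (k ∷ ks) * g i` reduces to `t i` for `i` other than `k`, and to
  -- `g k + t k` for `i = k`. It remains to carry `g k` past the earlier summands.
  absorb : ∀ k → g k + weigh g (λ i → count i ks) ≡ weigh g (λ i → count i (k ∷ ks))
  absorb A = stop (g A) (t A) (t B + (t C + (t D + (t G + t H))))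
  absorb B = pull (g B) (t A) (stop (g B) (t B) (t C + (t D + (t G + t H))))
  absorb C = pull (g C) (t A) (pull (g C) (t B) (stop (g C) (t C) (t D + (t G + t H))))
  absorb D = pull (g D) (t A) (pull (g D) (t B) (pull (g D) (t C) (stop (g D) (t D) (t G + t H))))
  absorb G = pull (g G) (t A) (pull (g G) (t B) (pull (g G) (t C) (pull (g G) (t D)
               (stop (g G) (t G) (t H)))))
  absorb H = pull (g H) (t A) (pull (g H) (t B) (pull (g H) (t C) (pull (g H) (t D)
               (pull (g H) (t G) refl))))

-- Every entry of `x ∷ w` begins exactly one pair, except the last, which begins none and is
-- supplied by `h (final x w)`.
∑-kinds-tops : ∀ (g : Kind → ℕ) (h : ℕ → ℕ) → (∀ x y → g (kind x y) ≡ h x) →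
               ∀ x w → ∑ (kinds x w) g + h (final x w) ≡ h x + ∑ w h
∑-kinds-tops g h eq x []      = +-comm 0 (h x)
∑-kinds-tops g h eq x (y ∷ w) = begin
  g (kind x y) + ∑ (kinds y w) g + h (final y w)   ≡⟨ +-assoc (g (kind x y)) _ _ ⟩
  g (kind x y) + (∑ (kinds y w) g + h (final y w)) ≡⟨ cong₂ _+_ (eq x y) (∑-kinds-tops g h eq y w) ⟩
  h x + (h y + ∑ w h)                              ∎
  where open ≡-Reasoning

-- Every entry of `w` ends exactly one pair, and `x` ends none.
∑-kinds-bottoms : ∀ (g : Kind → ℕ) (h : ℕ → ℕ) → (∀ x y → g (kind x y) ≡ h y) →
                  ∀ x w → ∑ (kinds x w) g ≡ ∑ w h
∑-kinds-bottoms g h eq x []      = refl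
∑-kinds-bottoms g h eq x (y ∷ w) = cong₂ _+_ (eq x y) (∑-kinds-bottoms g h eq y w)

∑-tabulate-adjacent : ∀ (g : Kind → ℕ) m (f : Fin (suc m) → ℕ) →
  sum (tabulate (λ i → g (kind (f (inject₁ i)) (f (suc i))))) ≡ ∑ (kinds (f zero) (tabulate (f ∘ suc))) g
∑-tabulate-adjacent g zero    f = refl
∑-tabulate-adjacent g (suc m) f = cong₂ _+_ refl (∑-tabulate-adjacent g m (f ∘ suc))

-- The pair statistics as counts of kinds

word : Permutation′ n → List ℕ
word π = tabulate (entry π)

-- The prepended 0 is even and smaller than every entry: the pair that it begins
-- counts for neither statistic, and every place except the end splits a pair.
kindsOf : Permutation′ n → List Kind
kindsOf π = kinds 0 (word π)

length-filter-adjacent : ∀ {R : Binary.Rel ℕ 0ℓ} (R? : Binary.Decidable R) (g : Kind → ℕ) →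
  (∀ x y → 𝟙 (does (R? x y)) ≡ g (kind x y)) → g G ≡ 0 → g H ≡ 0 →
  ∀ {m} (π : Permutation′ (suc m)) →
  length (filter (λ i → R? (entry π (inject₁ i)) (entry π (suc i))) (allFin m)) ≡
  ∑ (kindsOf π) g
length-filter-adjacent R? g eq gG≡0 gH≡0 {m} π = begin
  length (filter (λ i → R? (p (inject₁ i)) (p (suc i))) (allFin m))
    ≡⟨ length-filter≡∑ (λ i → R? (p (inject₁ i)) (p (suc i))) (allFin m) ⟩
  ∑ (allFin m) (λ i → 𝟙 (does (R? (p (inject₁ i)) (p (suc i)))))
    ≡⟨ ∑-cong (λ i → eq (p (inject₁ i)) (p (suc i))) (allFin m) ⟩
  ∑ (allFin m) (λ i → g (kind (p (inject₁ i)) (p (suc i))))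
    ≡⟨ cong sum (map-tabulate (λ i → i) (λ i → g (kind (p (inject₁ i)) (p (suc i))))) ⟩
  sum (tabulate (λ i → g (kind (p (inject₁ i)) (p (suc i)))))
    ≡⟨ ∑-tabulate-adjacent g m p ⟩
  ∑ (kinds (p zero) (tabulate (p ∘ suc))) g
    ≡⟨ cong (_+ ∑ (kinds (p zero) (tabulate (p ∘ suc))) g) (start (p zero)) ⟨
  ∑ (kindsOf π) g ∎
  where
  open ≡-Reasoning
  p = entry π

  -- Since 0 is even, the pair that it begins has kind `G` or `H`, where `g` vanishes.
  start : ∀ y → g (kind 0 y) ≡ 0
  start y with does (odd? y)
  ... | true  = gG≡0
  ... | false = gH≡0

S₁₀≡A+B : ∀ {m} (π : Permutation′ (suc m)) → S₁₀ π ≡ count A (kindsOf π) + count B (kindsOf π)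
S₁₀≡A+B π = begin
  S₁₀ π           ≡⟨ length-filter-adjacent (λ x y → (x >? y) ×-dec odd? x) g agree refl refl π ⟩
  ∑ (kindsOf π) g ≡⟨ ∑-kinds g (kindsOf π) ⟩
  weigh g m       ≡⟨ collect (m A) (m B) (m C) (m D) (m G) (m H) ⟩
  m A + m B       ∎
  where
  open ≡-Reasoning
  m : Kind → ℕ
  m i = count i (kindsOf π)

  g : Kind → ℕ
  g A = 1
  g B = 1
  g _ = 0

  agree : ∀ x y → 𝟙 (does ((x >? y) ×-dec odd? x)) ≡ g (kind x y)
  agree x y with does (odd? x) | does (odd? y) | does (y <? x)
  ... | true  | true  | true  = refl
  ... | true  | true  | false = refl
  ... | true  | false | true  = refl
  ... | true  | false | false = refl
  ... | false | true  | true  = refl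
  ... | false | true  | false = refl
  ... | false | false | true  = refl
  ... | false | false | false = refl

  collect : ∀ a b c d e f → a * 1 + (b * 1 + (c * 0 + (d * 0 + (e * 0 + f * 0)))) ≡ a + b
  collect = solve-∀

S₁₂≡A+C : ∀ {m} (π : Permutation′ (suc m)) → S₁₂ π ≡ count A (kindsOf π) + count C (kindsOf π)
S₁₂≡A+C π = begin
  S₁₂ π           ≡⟨ length-filter-adjacent (λ x y → odd? x ×-dec odd? y) g agree refl refl π ⟩
  ∑ (kindsOf π) g ≡⟨ ∑-kinds g (kindsOf π) ⟩
  weigh g m       ≡⟨ collect (m A) (m B) (m C) (m D) (m G) (m H) ⟩
  m A + m C       ∎
  where
  open ≡-Reasoning
  m : Kind → ℕ
  m i = count i (kindsOf π)

  g : Kind → ℕ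
  g k = 𝟙 (top k ∧ bottom k)

  agree : ∀ x y → 𝟙 (does (odd? x ×-dec odd? y)) ≡ g (kind x y)
  agree x y = sym (cong₂ (λ p q → 𝟙 (p ∧ q)) (top-kind x y) (bottom-kind x y))

  collect : ∀ a b c d e f → a * 1 + (b * 0 + (c * 1 + (d * 0 + (e * 0 + f * 0)))) ≡ a + c
  collect = solve-∀

-- Splitting a pair

-- A pair `x`, `y` split by a larger `v` becomes the ascent `x`, `v` and the descent `v`, `y`,
-- whatever the order of `x` and `y`. The Boolean says whether `v` is odd.
refine : Bool → Kind → List Kind
refine true  A = C ∷ A ∷ []
refine true  B = C ∷ B ∷ []
refine true  C = C ∷ A ∷ []
refine true  D = C ∷ B ∷ []
refine true  G = G ∷ A ∷ []
refine true  H = G ∷ B ∷ []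
refine false A = D ∷ G ∷ []
refine false B = D ∷ H ∷ []
refine false C = D ∷ G ∷ []
refine false D = D ∷ H ∷ []
refine false G = H ∷ G ∷ []
refine false H = H ∷ H ∷ []

kind-refine : ∀ {x y v} → x < v → y < v → kind x v ∷ kind v y ∷ [] ≡ refine (odd v) (kind x y)
kind-refine {x} {y} {v} x<v y<v
  rewrite dec-false (v <? x) (<⇒≯ x<v) | dec-true (y <? v) y<v
  with does (odd? x) | does (odd? y) | does (odd? v) | does (y <? x)
... | true  | true  | true  | true  = refl
... | true  | true  | true  | false = refl
... | true  | true  | false | true  = refl
... | true  | true  | false | false = refl
... | true  | false | true  | true  = refl
... | true  | false | true  | false = refl
... | true  | false | false | true  = refl
... | true  | false | false | false = refl
... | false | true  | true  | _     = refl
... | false | true  | false | _     = refl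
... | false | false | true  | _     = refl
... | false | false | false | _     = refl

-- The place after the last letter is left out: these are the insertions that split a pair of the
-- word with 0 prepended.
insertions : X → List X → List (List X)
insertions v []      = []
insertions v (x ∷ w) = (v ∷ x ∷ w) ∷ map (x ∷_) (insertions v w)

refinements : Bool → List Kind → List (List Kind)
refinements p []       = []
refinements p (k ∷ ks) = (refine p k ++ ks) ∷ map (k ∷_) (refinements p ks)

kinds-insertions : ∀ {v} x w → x < v → All (_< v) w →
                   map (kinds x) (insertions v w) ≡ refinements (odd v) (kinds x w)
kinds-insertions         x []      x<v []          = refl
kinds-insertions {v} x (y ∷ w) x<v (y<v ∷ w<v) = cong₂ _∷_
  (cong (_++ kinds y w) (kind-refine x<v y<v))
  (begin
    map (kinds x) (map (y ∷_) (insertions v w))       ≡⟨ map-∘ (insertions v w) ⟨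
    map (λ u → kind x y ∷ kinds y u) (insertions v w) ≡⟨ map-∘ (insertions v w) ⟩
    map (kind x y ∷_) (map (kinds y) (insertions v w)) ≡⟨ cong (map (kind x y ∷_)) (kinds-insertions y w y<v w<v) ⟩
    map (kind x y ∷_) (refinements (odd v) (kinds y w)) ∎)
  where open ≡-Reasoning

final-insertions : ∀ v x w → All (λ u → final x u ≡ final x w) (insertions v w)
final-insertions v x []      = []
final-insertions v x (y ∷ w) = refl ∷ All.map⁺ (final-insertions v y w)

kinds-∷ʳ : ∀ x w v → kinds x (w ∷ʳ v) ≡ kinds x w ∷ʳ kind (final x w) v
kinds-∷ʳ x []      v = refl
kinds-∷ʳ x (y ∷ w) v = cong (kind x y ∷_) (kinds-∷ʳ y w v)

final-∷ʳ : ∀ x w v → final x (w ∷ʳ v) ≡ v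
final-∷ʳ x []      v = refl
final-∷ʳ x (y ∷ w) v = final-∷ʳ y w v

final-<  : ∀ {v} x w → x < v → All (_< v) w → final x w < v
final-< x []      x<v []          = x<v
final-< x (y ∷ w) x<v (y<v ∷ w<v) = final-< y w y<v w<v

count-∷ʳ : ∀ i ks k → count i (ks ∷ʳ k) ≡ δ i k + count i ks
count-∷ʳ i ks k = trans (∑-++ (δ i) ks (k ∷ []))
  (trans (cong (λ r → count i ks + r) (+-identityʳ _)) (+-comm (count i ks) _))

count-∈ : ∀ {k ks} → δ k k ≡ 1 → k ∈ ks → count k ks ≡ suc (pred (count k ks))
count-∈ {k} δ≡1 (here refl) rewrite δ≡1 = refl
count-∈ {k} δ≡1 (there {x} {ks} k∈) rewrite count-∈ δ≡1 k∈ | +-suc (δ k x) (pred (count k ks)) = refl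

-- The counts of A, B, C after a new maximum, odd for true and even for false, has
-- split a pair of the given kind.  That pair is one of those counted, so pred
-- does not truncate.
update : Bool → Kind → (ℕ → ℕ → ℕ → ℕ) → ℕ → ℕ → ℕ → ℕ
update true  A φ a b c = φ a b (suc c)
update true  B φ a b c = φ a b (suc c)
update true  C φ a b c = φ (suc a) b c
update true  D φ a b c = φ a (suc b) (suc c)
update true  G φ a b c = φ (suc a) b c
update true  H φ a b c = φ a (suc b) c
update false A φ a b c = φ (pred a) b c
update false B φ a b c = φ a (pred b) c
update false C φ a b c = φ a b (pred c)
update false D φ a b c = φ a b c
update false G φ a b c = φ a b c
update false H φ a b c = φ a b c

on-counts : (ℕ → ℕ → ℕ → ℕ) → List Kind → ℕ
on-counts φ ks = φ (count A ks) (count B ks) (count C ks)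

-- `on-counts (shift k φ) ks` computes to `on-counts φ (k ∷ ks)`. A leading pair is thus absorbed
-- into `φ`, which lets the induction for `counts-refinements` descend to the tail.
shift : Kind → (ℕ → ℕ → ℕ → ℕ) → ℕ → ℕ → ℕ → ℕ
shift k φ a b c = φ (δ A k + a) (δ B k + b) (δ C k + c)

update-refine : ∀ p k φ ks →
  on-counts φ (refine p k ++ ks) ≡ on-counts (update p k φ) (k ∷ ks)
update-refine true  A φ ks = refl
update-refine true  B φ ks = refl
update-refine true  C φ ks = refl
update-refine true  D φ ks = refl
update-refine true  G φ ks = refl
update-refine true  H φ ks = refl
update-refine false A φ ks = refl
update-refine false B φ ks = refl
update-refine false C φ ks = refl
update-refine false D φ ks = refl
update-refine false G φ ks = refl
update-refine false H φ ks = refl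

-- Raising a count commutes with adding `δ`. So does lowering it by `pred`, because `k ∈ ks` makes
-- the lowered count positive.
update-shift : ∀ p k₀ {k} φ ks → k ∈ ks →
  on-counts (update p k (shift k₀ φ)) ks ≡ on-counts (update p k φ) (k₀ ∷ ks)
update-shift true  k₀ {A} φ ks k∈ rewrite +-suc (δ C k₀) (count C ks) = refl
update-shift true  k₀ {B} φ ks k∈ rewrite +-suc (δ C k₀) (count C ks) = refl
update-shift true  k₀ {C} φ ks k∈ rewrite +-suc (δ A k₀) (count A ks) = refl
update-shift true  k₀ {D} φ ks k∈
  rewrite +-suc (δ B k₀) (count B ks) | +-suc (δ C k₀) (count C ks) = refl
update-shift true  k₀ {G} φ ks k∈ rewrite +-suc (δ A k₀) (count A ks) = refl
update-shift true  k₀ {H} φ ks k∈ rewrite +-suc (δ B k₀) (count B ks) = refl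
update-shift false k₀ {A} φ ks k∈
  rewrite count-∈ refl k∈ | +-suc (δ A k₀) (pred (count A ks)) = refl
update-shift false k₀ {B} φ ks k∈
  rewrite count-∈ refl k∈ | +-suc (δ B k₀) (pred (count B ks)) = refl
update-shift false k₀ {C} φ ks k∈
  rewrite count-∈ refl k∈ | +-suc (δ C k₀) (pred (count C ks)) = refl
update-shift false k₀ {D} φ ks k∈ = refl
update-shift false k₀ {G} φ ks k∈ = refl
update-shift false k₀ {H} φ ks k∈ = refl

counts-refinements : ∀ p φ ks →
  map (on-counts φ) (refinements p ks) ≡ map (λ k → on-counts (update p k φ) ks) ks
counts-refinements p φ []       = refl
counts-refinements p φ (k₀ ∷ ks) = cong₂ _∷_ (update-refine p k₀ φ ks) (begin
  map (on-counts φ) (map (k₀ ∷_) (refinements p ks))  ≡⟨ map-∘ (refinements p ks) ⟨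
  map (on-counts (shift k₀ φ)) (refinements p ks)      ≡⟨ counts-refinements p (shift k₀ φ) ks ⟩
  map (λ k → on-counts (update p k (shift k₀ φ)) ks) ks ≡⟨ map-cong-local (All.tabulate (update-shift p k₀ φ ks)) ⟩
  map (λ k → on-counts (update p k φ) (k₀ ∷ ks)) ks    ∎)
  where open ≡-Reasoning

-- Words under insertion of the maximum

toℕ-punchIn-fromℕ : ∀ (i : Fin n) → toℕ (punchIn (fromℕ n) i) ≡ toℕ i
toℕ-punchIn-fromℕ zero    = refl
toℕ-punchIn-fromℕ (suc i) = cong suc (toℕ-punchIn-fromℕ i)

insertMax : Fin (suc n) → Permutation′ n → Permutation′ (suc n)
insertMax {n} j π = insert j (fromℕ n) π

entry-insertMax-same : ∀ j (π : Permutation′ n) → entry (insertMax j π) j ≡ suc n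
entry-insertMax-same {n} j π = cong suc (trans (cong toℕ (insert-same j (fromℕ n) π)) (Fin.toℕ-fromℕ n))

entry-insertMax-other : ∀ j (π : Permutation′ n) i → entry (insertMax j π) (punchIn j i) ≡ entry π i
entry-insertMax-other {n} j π i = cong suc
  (trans (cong toℕ (insert-punchIn j (fromℕ n) π i)) (toℕ-punchIn-fromℕ (π ⟨$⟩ʳ i)))

entry-insertMax : ∀ j (π : Permutation′ n) →
                  entry (insertMax j π) ≗ Vector.insertAt (entry π) j (suc n)
entry-insertMax {n} j π k with punchInView j k
... | same    = trans (entry-insertMax-same j π) (sym (Vector.insertAt-lookup (entry π) j (suc n)))
... | other i = trans (entry-insertMax-other j π i) (sym (Vector.insertAt-punchIn (entry π) j (suc n) i))

word-insertMax : ∀ j (π : Permutation′ n) →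
                 word (insertMax j π) ≡ tabulate (Vector.insertAt (entry π) j (suc n))
word-insertMax j π = tabulate-cong (entry-insertMax j π)

-- The positions `inject₁ i` are those in front of an existing letter; the remaining position
-- `fromℕ n` appends.
tabulate-insertAt-inject₁ : ∀ (f : Fin n → X) v →
  tabulate (λ i → tabulate (Vector.insertAt f (inject₁ i) v)) ≡ insertions v (tabulate f)
tabulate-insertAt-inject₁ {n = zero}  f v = refl
tabulate-insertAt-inject₁ {n = suc n} f v = cong ((v ∷ tabulate f) ∷_)
  (trans (sym (map-tabulate (λ i → tabulate (Vector.insertAt (f ∘ suc) (inject₁ i) v)) (f zero ∷_)))
         (cong (map (f zero ∷_)) (tabulate-insertAt-inject₁ (f ∘ suc) v)))

tabulate-insertAt-fromℕ : ∀ (f : Fin n → X) v →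
  tabulate (Vector.insertAt f (fromℕ n) v) ≡ tabulate f ∷ʳ v
tabulate-insertAt-fromℕ {n = zero}  f v = refl
tabulate-insertAt-fromℕ {n = suc n} f v = cong (f zero ∷_) (tabulate-insertAt-fromℕ (f ∘ suc) v)

tabulate-∷ʳ : ∀ (f : Fin (suc n) → X) → tabulate f ≡ tabulate (f ∘ inject₁) ∷ʳ f (fromℕ n)
tabulate-∷ʳ {n = zero}  f = refl
tabulate-∷ʳ {n = suc n} f = cong (f zero ∷_) (tabulate-∷ʳ (f ∘ suc))

final-tabulate : ∀ x (f : Fin (suc n) → ℕ) → final x (tabulate f) ≡ f (fromℕ n)
final-tabulate {zero}  x f = refl
final-tabulate {suc n} x f = final-tabulate (f zero) (f ∘ suc)

entry≤n : ∀ (π : Permutation′ n) i → entry π i ≤ n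
entry≤n π i = Fin.toℕ<n (π ⟨$⟩ʳ i)

-- The statistic S₁₇

InOrder-≤ : ∀ {π : Permutation′ n} {k l} → k ≤ l → InOrder π l → InOrder π k
InOrder-≤ k≤l ord s t s<t t≤k = ord s t s<t (≤-trans t≤k k≤l)

InOrder-resp-≈ : ∀ {π ρ : Permutation′ n} {k} → π ≈ ρ → InOrder π k → InOrder ρ k
InOrder-resp-≈ π≈ρ ord s t rewrite sym (π≈ρ s) | sym (π≈ρ t) = ord s t

-- The new entry exceeds `n` and hence `k`, so it is subject to no condition, and `punchIn j`
-- preserves the order of the other positions.
InOrder-insertMax⁺ : ∀ j {π : Permutation′ n} {k} → k ≤ n → InOrder π k → InOrder (insertMax j π) k
InOrder-insertMax⁺ j {π} {k} k≤n ord s t s<t t≤k with punchInView j s | punchInView j t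
... | _       | same    = contradiction
  (≤-trans (≤-reflexive (sym (entry-insertMax-same j π))) (≤-trans t≤k k≤n)) 1+n≰n
... | same    | other t = contradiction
  (≤-trans (≤-reflexive (sym (entry-insertMax-same j π))) (≤-trans (<⇒≤ s<t) (≤-trans t≤k k≤n))) 1+n≰n
... | other s | other t = ≰⇒> λ t≤s → <⇒≱
  (ord s t (subst₂ _<_ (entry-insertMax-other j π s) (entry-insertMax-other j π t) s<t)
           (subst (_≤ k) (entry-insertMax-other j π t) t≤k))
  (Fin.punchIn-cancel-≤ j t s t≤s)

InOrder-insertMax⁻ : ∀ j {π : Permutation′ n} {k} → InOrder (insertMax j π) k → InOrder π k
InOrder-insertMax⁻ j {π} {k} ord s t s<t t≤k = ≰⇒> λ t≤s → <⇒≱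
  (ord (punchIn j s) (punchIn j t)
       (subst₂ _<_ (sym (entry-insertMax-other j π s)) (sym (entry-insertMax-other j π t)) s<t)
       (subst (_≤ k) (sym (entry-insertMax-other j π t)) t≤k))
  (Fin.punchIn-mono-≤ j t s t≤s)

InOrder-insertMax-fromℕ : ∀ {π : Permutation′ n} → InOrder π n → InOrder (insertMax (fromℕ n) π) (suc n)
InOrder-insertMax-fromℕ {n} {π} ord s t s<t _ with punchInView (fromℕ n) s | punchInView (fromℕ n) t
... | same    | same    = contradiction s<t (<-irrefl refl)
... | same    | other t = contradiction
  (subst₂ _<_ (entry-insertMax-same (fromℕ n) π) (entry-insertMax-other (fromℕ n) π t) s<t)
  (≤⇒≯ (m≤n⇒m≤1+n (entry≤n π t)))
... | other s | same    =
  subst₂ _<_ (sym (toℕ-punchIn-fromℕ s)) (sym (Fin.toℕ-fromℕ n)) (Fin.toℕ<n s)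
... | other s | other t = subst₂ _<_ (sym (toℕ-punchIn-fromℕ s)) (sym (toℕ-punchIn-fromℕ t))
  (ord s t (subst₂ _<_ (entry-insertMax-other (fromℕ n) π s) (entry-insertMax-other (fromℕ n) π t) s<t)
           (entry≤n π t))

-- The last entry is smaller than the new maximum but stands to the right of it.
¬InOrder-insertMax-inject₁ : ∀ i (π : Permutation′ n) → ¬ InOrder (insertMax (inject₁ i) π) (suc n)
¬InOrder-insertMax-inject₁ {n} i π ord = <⇒≱
  (ord (fromℕ n) j last<max (≤-reflexive (entry-insertMax-same j π)))
  (Fin.≤fromℕ j)
  where
  j = inject₁ i

  last<max′ : ∀ {k} → k ≡ fromℕ n → PunchInView j k → entry (insertMax j π) k < entry (insertMax j π) j
  last<max′ eq same      = contradiction (sym eq) Fin.fromℕ≢inject₁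
  last<max′ eq (other k) = subst₂ _<_ (sym (entry-insertMax-other j π k))
    (sym (entry-insertMax-same j π)) (s≤s (entry≤n π k))

  last<max : entry (insertMax j π) (fromℕ n) < entry (insertMax j π) j
  last<max = last<max′ refl (punchInView j (fromℕ n))

-- This property determines its value, so `S₁₇` of an enlarged permutation is found by verifying it,
-- without computing the maximum of a filtered list.
record LargestInOrder {n} (π : Permutation′ n) (s : ℕ) : Set where
  field
    bounded : s ≤ n
    inOrder : InOrder π s
    largest : ∀ k → k ≤ n → InOrder π k → k ≤ s

open LargestInOrder

LargestInOrder-unique : ∀ {π : Permutation′ n} {s t} → LargestInOrder π s → LargestInOrder π t → s ≡ t
LargestInOrder-unique S T = ≤-antisym
  (largest T _ (bounded S) (inOrder S)) (largest S _ (bounded T) (inOrder T))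

S₁₇-largest : ∀ {m} (π : Permutation′ (suc m)) → LargestInOrder π (S₁₇ π)
S₁₇-largest {m} π = record
  { bounded = proj₁ both
  ; inOrder = proj₂ both
  ; largest = λ where
      zero    _   _   → z≤n
      (suc k) k<n ord → All.lookup (xs≤max 0 (filter (inOrder? π) candidates))
        (Membership.∈-filter⁺ (inOrder? π) (Membership.∈-map⁺ suc (Membership.∈-upTo⁺ k<n)) ord)
  }
  where
  candidates : List ℕ
  candidates = map suc (upTo (suc m))

  both : S₁₇ π ≤ suc m × InOrder π (S₁₇ π)
  both = argmax-all id {P = λ s → s ≤ suc m × InOrder π s}
    -- The default value 0 of `max` has to satisfy the property too; it does so vacuously, as no
    -- entry is at most 0.
    (z≤n , λ s t s<t t≤0 → contradiction (≤-trans s<t t≤0) λ ())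
    (All.zip (All.filter⁺ (inOrder? π) (All.map⁺ (All.all-upTo (suc m))) , All.all-filter (inOrder? π) candidates))

S₁₇-cong : ∀ {m} {π ρ : Permutation′ (suc m)} → π ≈ ρ → S₁₇ π ≡ S₁₇ ρ
S₁₇-cong {π = π} {ρ} π≈ρ = LargestInOrder-unique (S₁₇-largest π) record
  { bounded = bounded ρ-largest
  ; inOrder = InOrder-resp-≈ {π = ρ} {π} ρ≈π (inOrder ρ-largest)
  ; largest = λ k k≤n ord → largest ρ-largest k k≤n (InOrder-resp-≈ {π = π} {ρ} π≈ρ ord)
  }
  where
  ρ-largest = S₁₇-largest ρ
  ρ≈π : ρ ≈ π
  ρ≈π i = sym (π≈ρ i)

-- The new maximum is not last, so the new top value is excluded, and any smaller `k` is in order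
-- after the insertion exactly when it was before.
S₁₇-insertMax-inject₁ : ∀ {m} i (π : Permutation′ (suc m)) → S₁₇ (insertMax (inject₁ i) π) ≡ S₁₇ π
S₁₇-insertMax-inject₁ {m} i π = LargestInOrder-unique (S₁₇-largest (insertMax (inject₁ i) π)) record
  { bounded = m≤n⇒m≤1+n (bounded L)
  ; inOrder = InOrder-insertMax⁺ (inject₁ i) {π} (bounded L) (inOrder L)
  ; largest = λ k k≤1+n ord → largest L k
      (≤-pred (≤∧≢⇒< k≤1+n λ { refl → ¬InOrder-insertMax-inject₁ i π ord }))
      (InOrder-insertMax⁻ (inject₁ i) {π} ord)
  }
  where L = S₁₇-largest π

-- The value of `S₁₇` after `n + 1` is appended: it grows only from the value `n`, which means that
-- the permutation was the identity.
next : ℕ → ℕ → ℕ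
next n s = if does (s ≟ n) then suc n else s

next-≡ : ∀ n → next n n ≡ suc n
next-≡ n rewrite dec-true (n ≟ n) refl = refl

next-≢ : ∀ {n s} → s ≢ n → next n s ≡ s
next-≢ {n} {s} s≢n rewrite dec-false (s ≟ n) s≢n = refl

S₁₇-insertMax-fromℕ : ∀ {m} (π : Permutation′ (suc m)) →
                      S₁₇ (insertMax (fromℕ (suc m)) π) ≡ next (suc m) (S₁₇ π)
S₁₇-insertMax-fromℕ {m} π = extend (S₁₇ π ≟ suc m)
  where
  π⁺ = insertMax (fromℕ (suc m)) π
  L = S₁₇-largest π

  extend : Dec (S₁₇ π ≡ suc m) → S₁₇ π⁺ ≡ next (suc m) (S₁₇ π)
  extend (yes S≡n) = trans
    (LargestInOrder-unique (S₁₇-largest π⁺) record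
      { bounded = ≤-refl
      ; inOrder = InOrder-insertMax-fromℕ {π = π} (subst (InOrder π) S≡n (inOrder L))
      ; largest = λ _ k≤1+n _ → k≤1+n
      })
    (sym (trans (cong (next (suc m)) S≡n) (next-≡ (suc m))))
  extend (no S≢n) = trans
    (LargestInOrder-unique (S₁₇-largest π⁺) record
      { bounded = m≤n⇒m≤1+n (bounded L)
      ; inOrder = InOrder-insertMax⁺ (fromℕ (suc m)) {π} (bounded L) (inOrder L)
      ; largest = λ k k≤1+n ord → largest L k
          (≤-pred (≤∧≢⇒< k≤1+n λ { refl → ¬InOrder-1+n ord }))
          (InOrder-insertMax⁻ (fromℕ (suc m)) {π} ord)
      })
    (sym (next-≢ S≢n))
    where
    ¬InOrder-1+n : ¬ InOrder π⁺ (suc (suc m))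
    ¬InOrder-1+n ord = S≢n (≤-antisym (bounded L) (largest L (suc m) ≤-refl
      (InOrder-≤ {π = π} (n≤1+n (suc m)) (InOrder-insertMax⁻ (fromℕ (suc m)) {π} ord))))

-- A last entry smaller than the maximum would have to stand left of the position `t` of the
-- maximum, yet no position lies beyond the last.
S₁₇≡n⇒final≡n : ∀ {m} (π : Permutation′ (suc m)) → S₁₇ π ≡ suc m → final 0 (word π) ≡ suc m
S₁₇≡n⇒final≡n {m} π S≡n = trans (final-tabulate 0 (entry π))
  (≤-antisym (entry≤n π (fromℕ m)) (≮⇒≥ λ last<n → <⇒≱
    (subst (InOrder π) S≡n (inOrder (S₁₇-largest π)) (fromℕ m) t
      (subst (entry π (fromℕ m) <_) (sym entry-t) last<n) (≤-reflexive entry-t))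
    (Fin.≤fromℕ t)))
  where
  t = π ⟨$⟩ˡ fromℕ m
  entry-t : entry π t ≡ suc m
  entry-t = cong suc (trans (cong toℕ (Permutation.inverseʳ π)) (Fin.toℕ-fromℕ m))

-- Parity balance

upToSum : (ℕ → ℕ) → ℕ → ℕ
upToSum h n = sum (tabulate {n = n} (λ i → h (suc (toℕ i))))

sum-tabulate : ∀ (f : Fin n → ℕ) → sum (tabulate f) ≡ vsum f
sum-tabulate {zero}  f = refl
sum-tabulate {suc n} f = cong (λ r → f zero + r) (sum-tabulate (f ∘ suc))

∑-word : ∀ (π : Permutation′ n) h → ∑ (word π) h ≡ upToSum h n
∑-word {n} π h = begin
  sum (map h (tabulate (entry π)))     ≡⟨ cong sum (map-tabulate (entry π) h) ⟩
  sum (tabulate (h ∘ entry π))         ≡⟨ sum-tabulate (h ∘ entry π) ⟩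
  vsum (h ∘ entry π)                   ≡⟨ sum-permute (λ i → h (suc (toℕ i))) π ⟨
  vsum {n} (λ i → h (suc (toℕ i)))     ≡⟨ sum-tabulate {n} (λ i → h (suc (toℕ i))) ⟨
  upToSum h n                          ∎
  where open ≡-Reasoning

upToSum-1 : ∀ n → upToSum (λ _ → 1) n ≡ n
upToSum-1 zero    = refl
upToSum-1 (suc n) = cong suc (upToSum-1 n)

-- The hypothesis makes `n` even, so 1, ..., `n` falls into consecutive pairs of an odd and an even
-- number; hence the induction in steps of two.
odds≡evens : ∀ n → odd (suc n) ≡ true → upToSum (𝟙 ∘ odd) n ≡ upToSum (𝟙 ∘ not ∘ odd) n
odds≡evens zero          _ = refl
odds≡evens (suc (suc n)) p = cong suc (odds≡evens n p)

-- The transfer operator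

-- Test functions on the states of the Markov chain. Equality of sums for all weights expresses
-- equality of joint distributions.
Weight : Set
Weight = (a b c : ℕ) (last-odd : Bool) (s : ℕ) → ℕ

swap : Weight → Weight
swap φ a b c = φ a c b

stat : ∀ {m} → Weight → Permutation′ (suc m) → ℕ
stat φ π = φ (count A (kindsOf π)) (count B (kindsOf π)) (count C (kindsOf π))
             (odd (final 0 (word π))) (S₁₇ π)

-- transfer n φ is the operator dual to inserting n + 1: it sums φ over the results
-- of all insertions.  The coefficients are the numbers of pairs of each kind,
-- written in terms of a, b, c and e only so that b ↔ c can be applied to them.
transferInner : Bool → ℕ → Weight → Weight
transferInner false n φ a b c e s =
  a * φ (pred a) b c e s + (b * φ a (pred b) c e s + (c * φ a b (pred c) e s +
  (n ∸ (a + b + c)) * φ a b c e s))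
transferInner true  n φ a b c e s =
  (a + b) * φ a b (suc c) e s + ((a + c + 𝟙 e) * φ a (suc b) c e s +
  ((m ∸ a) * φ (suc a) b c e s + (m ∸ (a + b + c + 𝟙 e)) * φ a (suc b) (suc c) e s))
  where m = upToSum (𝟙 ∘ odd) n

transferLast : Bool → ℕ → Weight → Weight
transferLast false n φ a b c e     s = φ a b c false (next n s)
-- Here n is even and the last entry is odd, so S₁₇ ≢ n: no use of next keeps the
-- clause in line with the summands of transferInner that it is combined with.
transferLast true  n φ a b c true  s = φ a b (suc c) true s
transferLast true  n φ a b c false s = φ a b c true (next n s)

transfer : ℕ → Weight → Weight
transfer n φ a b c e s =
  transferInner (odd (suc n)) n φ a b c e s + transferLast (odd (suc n)) n φ a b c e s

-- For even `n + 1` the summands that lower `b` and `c` change places. For odd `n + 1` those that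
-- raise `b` alone and `c` alone do: if the last entry is odd, appending completes the coefficient
-- `a + b` to `a + b + 1`, the mirror image of `a + c + 1`; otherwise they are `a + b` and `a + c`.
-- All other coefficients are symmetric in `b` and `c`.
transfer-swap : ∀ n φ a b c e s → transfer n φ a c b e s ≡ transfer n (swap φ) a b c e s
transfer-swap n φ a b c e s = by-parity (odd (suc n)) e
  where
  m = upToSum (𝟙 ∘ odd) n

  reorder : ∀ a b c → a + c + b ≡ a + b + c
  reorder = solve-∀

  even : ∀ x y z w l → x + (y + (z + w)) + l ≡ x + (z + (y + w)) + l
  even = solve-∀

  odd-even : ∀ a b c x y z w l →
    (a + c) * x + ((a + b + 0) * y + (z + w)) + l ≡ (a + b) * y + ((a + c + 0) * x + (z + w)) + l
  odd-even = solve-∀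

  odd-odd : ∀ a b c x y z w →
    (a + c) * x + ((a + b + 1) * y + (z + w)) + x ≡ (a + b) * y + ((a + c + 1) * x + (z + w)) + y
  odd-odd = solve-∀

  by-parity : ∀ p e →
    transferInner p n φ a c b e s + transferLast p n φ a c b e s ≡
    transferInner p n (swap φ) a b c e s + transferLast p n (swap φ) a b c e s
  by-parity false e rewrite reorder a b c =
    even (a * φ (pred a) c b e s) (c * φ a (pred c) b e s) (b * φ a c (pred b) e s)
         ((n ∸ (a + b + c)) * φ a c b e s) (φ a c b false (next n s))
  by-parity true true  rewrite reorder a b c =
    odd-odd a b c (φ a c (suc b) true s) (φ a (suc c) b true s)
      ((m ∸ a) * φ (suc a) c b true s) ((m ∸ (a + b + c + 1)) * φ a (suc c) (suc b) true s)
  by-parity true false rewrite reorder a b c =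
    odd-even a b c (φ a c (suc b) false s) (φ a (suc c) b false s)
      ((m ∸ a) * φ (suc a) c b false s) ((m ∸ (a + b + c + 0)) * φ a (suc c) (suc b) false s)
      (φ a c b true (next n s))

∸-from-+ : ∀ x {y z} → x + y ≡ z → y ≡ z ∸ x
∸-from-+ x {y} refl = sym (m+n∸m≡n x y)

-- Numbers of pairs of each kind

module _ (π : Permutation′ n) where
  private
    a = count A (kindsOf π)
    b = count B (kindsOf π)
    c = count C (kindsOf π)
    d = count D (kindsOf π)
    g = count G (kindsOf π)
    h = count H (kindsOf π)
    last-odd = odd (final 0 (word π))
    e = 𝟙 last-odd

    entries : ∀ (wt : Kind → ℕ) (f : ℕ → ℕ) → (∀ x y → wt (kind x y) ≡ f y) →
              weigh wt (λ i → count i (kindsOf π)) ≡ upToSum f n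
    entries wt f eq = begin
      weigh wt (λ i → count i (kindsOf π)) ≡⟨ ∑-kinds wt (kindsOf π) ⟨
      ∑ (kindsOf π) wt                     ≡⟨ ∑-kinds-bottoms wt f eq 0 (word π) ⟩
      ∑ (word π) f                         ≡⟨ ∑-word π f ⟩
      upToSum f n                          ∎
      where open ≡-Reasoning

  all-pairs : (a + b + c) + (d + g + h) ≡ n
  all-pairs = trans (collect a b c d g h) (trans (entries (λ _ → 1) (λ _ → 1) (λ _ _ → refl)) (upToSum-1 n))
    where
    collect : ∀ a b c d g h → (a + b + c) + (d + g + h) ≡
              a * 1 + (b * 1 + (c * 1 + (d * 1 + (g * 1 + h * 1))))
    collect = solve-∀

  odd-bottoms : a + (c + g) ≡ upToSum (𝟙 ∘ odd) n
  odd-bottoms = trans (collect a b c d g h) (entries (𝟙 ∘ bottom) (𝟙 ∘ odd) (λ x y → cong 𝟙 (bottom-kind x y)))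
    where
    collect : ∀ a b c d g h → a + (c + g) ≡ a * 1 + (b * 0 + (c * 1 + (d * 0 + (g * 1 + h * 0))))
    collect = solve-∀

  even-bottoms : b + d + h ≡ upToSum (𝟙 ∘ not ∘ odd) n
  even-bottoms = trans (collect a b c d g h) (entries (𝟙 ∘ not ∘ bottom) (𝟙 ∘ not ∘ odd)
                       (λ x y → cong (𝟙 ∘ not) (bottom-kind x y)))
    where
    collect : ∀ a b c d g h → b + d + h ≡ a * 0 + (b * 1 + (c * 0 + (d * 1 + (g * 0 + h * 1))))
    collect = solve-∀

  -- Odd entries are counted by the pairs that they begin. A last odd entry begins none and
  -- contributes `e`, and the prepended 0 is not odd.
  odd-tops : (a + b + c + e) + d ≡ upToSum (𝟙 ∘ odd) n
  odd-tops = begin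
    (a + b + c + e) + d
      ≡⟨ collect a b c d g h e ⟩
    weigh (𝟙 ∘ top) (λ i → count i (kindsOf π)) + e
      ≡⟨ cong (_+ e) (∑-kinds (𝟙 ∘ top) (kindsOf π)) ⟨
    ∑ (kindsOf π) (𝟙 ∘ top) + e
      ≡⟨ ∑-kinds-tops (𝟙 ∘ top) (𝟙 ∘ odd) (λ x y → cong 𝟙 (top-kind x y)) 0 (word π) ⟩
    ∑ (word π) (𝟙 ∘ odd)
      ≡⟨ ∑-word π (𝟙 ∘ odd) ⟩
    upToSum (𝟙 ∘ odd) n ∎
    where
    open ≡-Reasoning
    collect : ∀ a b c d g h e → (a + b + c + e) + d ≡
              a * 1 + (b * 1 + (c * 1 + (d * 1 + (g * 0 + h * 0)))) + e
    collect = solve-∀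

  -- Even entries, counted by the pairs that they end, are as many as the odd ones, counted by
  -- `odd-tops`; cancelling `b + d` leaves `h`.
  even-pairs : odd (suc n) ≡ true → h ≡ a + c + e
  even-pairs 1+n-odd = +-cancelˡ-≡ (b + d) h (a + c + e) (begin
    b + d + h                  ≡⟨ even-bottoms ⟩
    upToSum (𝟙 ∘ not ∘ odd) n  ≡⟨ odds≡evens n 1+n-odd ⟨
    upToSum (𝟙 ∘ odd) n        ≡⟨ odd-tops ⟨
    (a + b + c + e) + d        ≡⟨ rearrange a b c d e ⟩
    b + d + (a + c + e)        ∎)
    where
    open ≡-Reasoning
    rearrange : ∀ a b c d e → (a + b + c + e) + d ≡ b + d + (a + c + e)
    rearrange = solve-∀

  -- Kinds with the same effect are merged. For an odd maximum `A` and `B` raise `c`, `C` and `G`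
  -- raise `a`, `H` raises `b`, and `D` raises both `b` and `c`; for an even one `D`, `G` and `H`
  -- change nothing. The balance equations above then eliminate `d`, `g` and `h`.
  weigh-update : ∀ p φ s → odd (suc n) ≡ p →
    weigh (λ k → on-counts (update p k (λ a b c → φ a b c last-odd s)) (kindsOf π)) (λ i → count i (kindsOf π))
    ≡ transferInner p n φ a b c last-odd s
  weigh-update false φ s _ = trans
    (collect a b c d g h (ψ (pred a) b c) (ψ a (pred b) c) (ψ a b (pred c)) (ψ a b c))
    (cong (λ k → a * ψ (pred a) b c + (b * ψ a (pred b) c + (c * ψ a b (pred c) + k * ψ a b c)))
      (∸-from-+ (a + b + c) all-pairs))
    where
    ψ : ℕ → ℕ → ℕ → ℕ
    ψ a b c = φ a b c last-odd s

    collect : ∀ a b c d g h x y z w → a * x + (b * y + (c * z + (d * w + (g * w + h * w)))) ≡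
                                      a * x + (b * y + (c * z + (d + g + h) * w))
    collect = solve-∀
  weigh-update true φ s parity = trans
    (collect a b c d g h (ψ a b (suc c)) (ψ a (suc b) c) (ψ (suc a) b c) (ψ a (suc b) (suc c)))
    (cong (λ k → (a + b) * ψ a b (suc c) + k)
      (cong₂ _+_ (cong (_* ψ a (suc b) c) (even-pairs parity))
        (cong₂ _+_ (cong (_* ψ (suc a) b c) (∸-from-+ a odd-bottoms))
                   (cong (_* ψ a (suc b) (suc c)) (∸-from-+ (a + b + c + e) odd-tops)))))
    where
    ψ : ℕ → ℕ → ℕ → ℕ
    ψ a b c = φ a b c last-odd s

    collect : ∀ a b c d g h x y z w → a * x + (b * x + (c * z + (d * w + (g * z + h * y)))) ≡
                                      (a + b) * x + (h * y + ((c + g) * z + d * w))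
    collect = solve-∀

-- Sums over all insertions of the maximum

word< : ∀ (π : Permutation′ n) → All (_< suc n) (word π)
word< π = All.tabulate⁺ (λ i → s≤s (entry≤n π i))

on-word : Weight → ℕ → List ℕ → ℕ
on-word φ s w = φ (count A ks) (count B ks) (count C ks) (odd (final 0 w)) s
  where ks = kinds 0 w

∑-insertions : ∀ {m} φ (π : Permutation′ (suc m)) →
  ∑ (insertions (suc (suc m)) (word π)) (on-word φ (S₁₇ π)) ≡
  stat (transferInner (odd (suc (suc m))) (suc m) φ) π
∑-insertions {m} φ π = begin
  ∑ us (on-word φ s)
    -- Insertion before a letter keeps the last entry, so its parity can be fixed and only the
    -- counts vary.
    ≡⟨ cong sum (map-cong-local (All.map (λ {u} eq → cong (λ x → φ₃ u (odd x)) eq) (final-insertions v 0 w))) ⟩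
  ∑ us (on-counts φ′ ∘ kinds 0)
    ≡⟨ ∑-map (on-counts φ′) (kinds 0) us ⟨
  ∑ (map (kinds 0) us) (on-counts φ′)
    ≡⟨ cong (λ kss → ∑ kss (on-counts φ′)) (kinds-insertions 0 w (s≤s z≤n) (word< π)) ⟩
  ∑ (refinements (odd v) ks) (on-counts φ′)
    ≡⟨ cong sum (counts-refinements (odd v) φ′ ks) ⟩
  ∑ ks (λ k → on-counts (update (odd v) k φ′) ks)
    ≡⟨ ∑-kinds (λ k → on-counts (update (odd v) k φ′) ks) ks ⟩
  weigh (λ k → on-counts (update (odd v) k φ′) ks) (λ i → count i ks)
    ≡⟨ weigh-update π (odd v) φ s refl ⟩
  stat (transferInner (odd v) (suc m) φ) π ∎
  where
  open ≡-Reasoning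
  v = suc (suc m)
  w = word π
  s = S₁₇ π
  ks = kinds 0 w
  us = insertions v w

  φ′ : ℕ → ℕ → ℕ → ℕ
  φ′ a b c = φ a b c (odd (final 0 w)) s

  φ₃ : List ℕ → Bool → ℕ
  φ₃ u e = φ (count A (kinds 0 u)) (count B (kinds 0 u)) (count C (kinds 0 u)) e s

-- If `S₁₇ π` were the full length, the last entry would be that length, which is even because its
-- successor is odd. This justifies the omission of `next` in `transferLast`.
next-odd-final : ∀ {m} (π : Permutation′ (suc m)) → odd (suc (suc m)) ≡ true →
                 odd (final 0 (word π)) ≡ true → next (suc m) (S₁₇ π) ≡ S₁₇ π
next-odd-final {m} π 2+m-odd final-odd = next-≢ λ S≡n →
  contradiction (trans (sym (cong odd (S₁₇≡n⇒final≡n π S≡n))) final-odd)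
                (not-both m 2+m-odd)
  where
  not-both : ∀ m → odd (suc (suc m)) ≡ true → odd (suc m) ≢ true
  not-both (suc (suc m)) p q = not-both m p q

-- The appended entry exceeds the last one, so the new pair is an ascent: `C` if both entries are
-- odd, and otherwise of a kind that leaves the counts of `A`, `B`, `C` unchanged.
on-word-∷ʳ : ∀ φ n s w → All (_< suc n) w →
  (odd (suc n) ≡ true → odd (final 0 w) ≡ true → next n s ≡ s) →
  on-word φ (next n s) (w ∷ʳ suc n) ≡ on-word (transferLast (odd (suc n)) n φ) s w
on-word-∷ʳ φ n s w w<v next≡s
  rewrite kinds-∷ʳ 0 w (suc n) | final-∷ʳ 0 w (suc n)
        | count-∷ʳ A (kinds 0 w) (kind (final 0 w) (suc n))
        | count-∷ʳ B (kinds 0 w) (kind (final 0 w) (suc n))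
        | count-∷ʳ C (kinds 0 w) (kind (final 0 w) (suc n))
  = by-parity (odd (suc n)) (odd (final 0 w)) refl refl
      (dec-false (suc n <? final 0 w) (<⇒≯ (final-< 0 w (s≤s z≤n) w<v)))
  where
  a = count A (kinds 0 w)
  b = count B (kinds 0 w)
  c = count C (kinds 0 w)

  by-parity : ∀ p e {r} → odd (suc n) ≡ p → odd (final 0 w) ≡ e → r ≡ false →
    φ (δ A (classify e p r) + a) (δ B (classify e p r) + b) (δ C (classify e p r) + c) p (next n s) ≡
    transferLast p n φ a b c e s
  by-parity true  true  p e refl = cong (φ a b (suc c) true) (next≡s p e)
  by-parity true  false _ _ refl = refl
  by-parity false true  _ _ refl = refl
  by-parity false false _ _ refl = refl

-- All positions but the last split a pair and give `transferInner`; the last position appends and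
-- gives `transferLast`.
stat-transfer : ∀ {m} φ (π : Permutation′ (suc m)) →
  ∑ (allFin (suc (suc m))) (λ j → stat φ (insertMax j π)) ≡ stat (transfer (suc m) φ) π
stat-transfer {m} φ π = begin
  ∑ (allFin (suc (suc m))) (λ j → stat φ (insertMax j π))
    ≡⟨ cong sum (trans (map-tabulate id F) (tabulate-∷ʳ F)) ⟩
  sum (tabulate (F ∘ inject₁) ∷ʳ F (fromℕ (suc m)))
    ≡⟨ cong sum (cong₂ _∷ʳ_ inner (cong₂ (on-word φ) (S₁₇-insertMax-fromℕ π)
         (trans (word-insertMax (fromℕ (suc m)) π) (tabulate-insertAt-fromℕ (entry π) (suc (suc m)))))) ⟩
  sum (map (on-word φ (S₁₇ π)) us ∷ʳ on-word φ (next (suc m) (S₁₇ π)) (word π ∷ʳ suc (suc m)))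
    ≡⟨ sum-∷ʳ (map (on-word φ (S₁₇ π)) us) _ ⟩
  ∑ us (on-word φ (S₁₇ π)) + on-word φ (next (suc m) (S₁₇ π)) (word π ∷ʳ suc (suc m))
    ≡⟨ cong₂ _+_ (∑-insertions φ π)
         (on-word-∷ʳ φ (suc m) (S₁₇ π) (word π) (word< π) (next-odd-final π)) ⟩
  stat (transfer (suc m) φ) π ∎
  where
  open ≡-Reasoning
  us = insertions (suc (suc m)) (word π)

  F : Fin (suc (suc m)) → ℕ
  F j = stat φ (insertMax j π)

  inner : tabulate (F ∘ inject₁) ≡ map (on-word φ (S₁₇ π)) us
  inner = begin
    tabulate (F ∘ inject₁)
      ≡⟨ tabulate-cong (λ i → cong₂ (on-word φ) (S₁₇-insertMax-inject₁ i π) (word-insertMax (inject₁ i) π)) ⟩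
    tabulate (λ i → on-word φ (S₁₇ π) (tabulate (Vector.insertAt (entry π) (inject₁ i) (suc (suc m)))))
      ≡⟨ map-tabulate (λ i → tabulate (Vector.insertAt (entry π) (inject₁ i) (suc (suc m)))) (on-word φ (S₁₇ π)) ⟨
    map (on-word φ (S₁₇ π)) (tabulate (λ i → tabulate (Vector.insertAt (entry π) (inject₁ i) (suc (suc m)))))
      ≡⟨ cong (map (on-word φ (S₁₇ π))) (tabulate-insertAt-inject₁ (entry π) (suc (suc m))) ⟩
    map (on-word φ (S₁₇ π)) us ∎

  sum-∷ʳ : ∀ xs x → sum (xs ∷ʳ x) ≡ sum xs + x
  sum-∷ʳ []       x = +-identityʳ x
  sum-∷ʳ (y ∷ xs) x = trans (cong (λ z → y + z) (sum-∷ʳ xs x)) (sym (+-assoc y (sum xs) x))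

-- Equidistribution

-- The induction needs all weights at once, as the hypothesis is applied to `transfer (suc m) φ`. It
-- starts from the single permutation of length 1, whose only pair is 0, 1 of kind `G`, so that all
-- three counts are 0.
∑-stat-swap : ∀ m φ → ∑ (permutationsByMax (suc m)) (stat φ) ≡ ∑ (permutationsByMax (suc m)) (stat (swap φ))
∑-stat-swap zero    φ = refl
∑-stat-swap (suc m) φ = begin
  ∑ (permutationsByMax (suc (suc m))) (stat φ)                ≡⟨ unfold φ ⟩
  ∑ (permutationsByMax (suc m)) (stat (transfer (suc m) φ))   ≡⟨ ∑-stat-swap m (transfer (suc m) φ) ⟩
  ∑ (permutationsByMax (suc m)) (stat (swap (transfer (suc m) φ)))
    ≡⟨ ∑-cong (λ π → transfer-swap (suc m) φ (count A (kindsOf π)) (count B (kindsOf π)) (count C (kindsOf π))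
                       (odd (final 0 (word π))) (S₁₇ π)) (permutationsByMax (suc m)) ⟩
  ∑ (permutationsByMax (suc m)) (stat (transfer (suc m) (swap φ))) ≡⟨ unfold (swap φ) ⟨
  ∑ (permutationsByMax (suc (suc m))) (stat (swap φ))         ∎
  where
  open ≡-Reasoning
  unfold : ∀ ψ → ∑ (permutationsByMax (suc (suc m))) (stat ψ) ≡
                 ∑ (permutationsByMax (suc m)) (stat (transfer (suc m) ψ))
  unfold ψ = trans
    (∑-cartesianProductWith (stat ψ) (λ π j → insertMax j π) (permutationsByMax (suc m)) (allFin (suc (suc m))))
    (∑-cong (stat-transfer ψ) (permutationsByMax (suc m)))

stat-cong : ∀ {m} φ {π ρ : Permutation′ (suc m)} → π ≈ ρ → stat φ π ≡ stat φ ρ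
stat-cong φ {π} {ρ} π≈ρ = cong₂ (on-word φ) (S₁₇-cong {π = π} {ρ} π≈ρ)
  (tabulate-cong (λ i → cong (suc ∘ toℕ) (π≈ρ i)))

corollary1p4 : ∀ (m : ℕ) (a b c : ℤ) →
    # (λ (p : Permutation′ (suc m)) → (+ S₁₀ p , + S₁₂ p , + S₁₇ p) ≟³ (a , b , c))
    ≡ # (λ (p : Permutation′ (suc m)) → (+ S₁₂ p , + S₁₀ p , + S₁₇ p) ≟³ (a , b , c))
corollary1p4 m a b c = begin
  # (λ (p : Permutation′ (suc m)) → (+ S₁₀ p , + S₁₂ p , + S₁₇ p) ≟³ (a , b , c))
    ≡⟨ length-filter≡∑ (λ p → (+ S₁₀ p , + S₁₂ p , + S₁₇ p) ≟³ (a , b , c)) (permutations (suc m)) ⟩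
  ∑ (permutations (suc m)) (λ p → hit (S₁₀ p) (S₁₂ p) (S₁₇ p))
    ≡⟨ ∑-cong (λ p → cong₂ (λ x y → hit x y (S₁₇ p)) (S₁₀≡A+B p) (S₁₂≡A+C p)) (permutations (suc m)) ⟩
  ∑ (permutations (suc m)) (stat φ)
    ≡⟨ ∑-permutations {n = suc m} (λ {π} {ρ} → stat-cong φ {π} {ρ}) ⟩
  ∑ (permutationsByMax (suc m)) (stat φ)
    ≡⟨ ∑-stat-swap m φ ⟩
  ∑ (permutationsByMax (suc m)) (stat (swap φ))
    ≡⟨ ∑-permutations {n = suc m} (λ {π} {ρ} → stat-cong (swap φ) {π} {ρ}) ⟨
  ∑ (permutations (suc m)) (stat (swap φ))
    ≡⟨ ∑-cong (λ p → cong₂ (λ x y → hit x y (S₁₇ p)) (S₁₂≡A+C p) (S₁₀≡A+B p)) (permutations (suc m)) ⟨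
  ∑ (permutations (suc m)) (λ p → hit (S₁₂ p) (S₁₀ p) (S₁₇ p))
    ≡⟨ length-filter≡∑ (λ p → (+ S₁₂ p , + S₁₀ p , + S₁₇ p) ≟³ (a , b , c)) (permutations (suc m)) ⟨
  # (λ (p : Permutation′ (suc m)) → (+ S₁₂ p , + S₁₀ p , + S₁₇ p) ≟³ (a , b , c)) ∎
  where
  open ≡-Reasoning

  hit : ℕ → ℕ → ℕ → ℕ
  hit x y z = 𝟙 (does ((+ x , + y , + z) ≟³ (a , b , c)))

  -- The bound `a`, `b`, `c` are the counts of `A`, `B`, `C`; the integers of the theorem enter
  -- through `hit`. Exchanging `b` and `c` exchanges `a + b` with `a + c`, that is, `S₁₀` with
  -- `S₁₂`.
  φ : Weight
  φ a b c _ s = hit (a + b) (a + c) s
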